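{- Let $\mathcal{G}=(V,E,\lambda)$ be a happy compressed temporal graph. Then the following hold. (i) For all edges $e_1,e_2,e_3\in E$: if $e_1\leadsto e_2$ and $e_2\leadsto e_3$, then $e_1\leadsto e_3$. (ii) For every vertex $v$ and edges $e_1,e_2$: if $v\leadsto e_1$ and $e_1\leadsto e_2$, then $v\leadsto e_2$. (iii) For all vertices $v,v'$ and every edge $e$: if $v\leadsto e$ and $e\leadsto v'$, then $v\leadsto v'$. (iv) For all non-isolated vertices $u,v$: if $v\leadsto u$, then $e^-(v)\leadsto u$, $v\leadsto e^+(u)$, and $e^-(v)\leadsto e^+(u)$. (v) If $\mathcal{G}$ is temporally connected (and $|V|\ge 2$), then for all $u,v\in V$: $e^-(u)\leadsto v$, $u\leadsto e^+(v)$, and $e^-(u)\leadsto e^+(v)$. (vi) If $e_1$ and $e_2$ are distinct edges, then $e_1\not\leadsto e_2$ or $e_2\not\leadsto e_1$.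
   Context: A happy temporal graph is a triple $\mathcal{G}=(V,E,\lambda)$ where $(V,E)$ is a finite simple undirected graph (the footprint) and $\lambda:E\to\{1,2,3,\dots\}$ assigns a single time label to each edge, such that two distinct edges sharing an endpoint have different labels. It is compressed if for every edge $e$ with $\lambda(e)>1$ there is an edge $e'$ adjacent to $e$ with $\lambda(e')=\lambda(e)-1$. A temporal walk is a walk in the footprint along which edge labels are strictly increasing (so no edge is repeated); the empty walk at a vertex is allowed. For vertices $u,v$ write $u\leadsto v$ if there is a temporal walk from $u$ to $v$. For a vertex $v$ and edges $e,e'$: $v\leadsto e$ means some temporal walk starts at $v$ and traverses $e$ at some point; $e\leadsto v$ means some temporal walk traverses $e$ at some point and ends at $v$; $e\leadsto e'$ means some temporal walk traverses $e$ and $e'$ in this order, not necessarily consecutively (with $e\leadsto e$ always). Edges may be traversed in either direction. $\mathcal{G}$ is temporally connected if $u\leadsto v$ for all $u,v\in V$. For a non-isolated vertex $v$, $e^-(v)$ and $e^+(v)$ denote the edges incident to $v$ with the smallest and largest label, respectively. -}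

module Defs where

open import Data.Nat using (ℕ; _∸_; _≤_; _<_)
open import Data.Fin using (Fin; _≟_)
open import Data.List using (List; []; _∷_; filter; allFin)
open import Data.List.Extrema.Nat
  using (argmin; argmax; argmin-all; argmax-all; f[argmin]≤f[xs]; f[xs]≤f[argmax])
open import Data.List.Membership.Propositional using (_∈_)
open import Data.List.Membership.Propositional.Properties using (∈-filter⁺; ∈-allFin)
open import Data.List.Relation.Binary.Sublist.Propositional using (_⊆_)
open import Data.List.Relation.Unary.All as All using ()
open import Data.List.Relation.Unary.All.Properties using (all-filter)
open import Data.List.Relation.Unary.Linked using (Linked)
open import Data.Product using (∃; ∃-syntax; _×_; _,_)
open import Data.Sum using (_⊎_)
open import Relation.Nullary using (Dec)
open import Relation.Nullary.Decidable using (_⊎-dec_)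
open import Relation.Binary.PropositionalEquality using (_≡_; _≢_)

-- Vertices and edges are enumerated by Fin.  The order of the two stored
-- endpoints carries no meaning: everything below uses them only through the
-- symmetric relations Joins and Incident.
record SimpleGraph : Set where
  field
    ∣V∣ ∣E∣ : ℕ

  Vertex : Set
  Vertex = Fin ∣V∣

  Edge : Set
  Edge = Fin ∣E∣

  field
    end₁ end₂ : Edge → Vertex

  Joins : Edge → Vertex → Vertex → Set
  Joins e u v = (end₁ e ≡ u × end₂ e ≡ v) ⊎ (end₁ e ≡ v × end₂ e ≡ u)

  Incident : Vertex → Edge → Set
  Incident v e = end₁ e ≡ v ⊎ end₂ e ≡ v

  incident? : ∀ v e → Dec (Incident v e)
  incident? v e = (end₁ e ≟ v) ⊎-dec (end₂ e ≟ v)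

  Adjacent : Edge → Edge → Set
  Adjacent e e′ = e ≢ e′ × ∃[ v ] (Incident v e × Incident v e′)

  field
    no-loops          : ∀ e → end₁ e ≢ end₂ e
    no-parallel-edges : ∀ {e e′ u v} → Joins e u v → Joins e′ u v → e ≡ e′

  NonIsolated : Vertex → Set
  NonIsolated v = ∃[ e ] Incident v e

  infixr 5 _∷⟨_⟩_

  data Walk : Vertex → Vertex → Set where
    []     : ∀ {v} → Walk v v
    _∷⟨_⟩_ : ∀ {u v w} (e : Edge) → Joins e u v → Walk v w → Walk u w

  walkEdges : ∀ {u v} → Walk u v → List Edge
  walkEdges []           = []
  walkEdges (e ∷⟨ _ ⟩ w) = e ∷ walkEdges w

record HappyTemporalGraph : Set where
  field
    footprint : SimpleGraph

  open SimpleGraph footprint public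

  field
    label          : Edge → ℕ
    label-positive : ∀ e → 1 ≤ label e
    label-proper   : ∀ {e e′} → Adjacent e e′ → label e ≢ label e′

  Compressed : Set
  Compressed = ∀ e → 1 < label e → ∃[ e′ ] (Adjacent e′ e × label e′ ≡ label e ∸ 1)

  Temporal : ∀ {u v} → Walk u v → Set
  Temporal w = Linked (λ e e′ → label e < label e′) (walkEdges w)

  -- The superscripts tell whether each side is a vertex or an edge.
  infix 4 _ᵛ⇝ᵛ_ _ᵛ⇝ᵉ_ _ᵉ⇝ᵛ_ _ᵉ⇝ᵉ_

  _ᵛ⇝ᵛ_ : Vertex → Vertex → Set
  u ᵛ⇝ᵛ v = ∃[ w ] Temporal {u} {v} w

  _ᵛ⇝ᵉ_ : Vertex → Edge → Set
  v ᵛ⇝ᵉ e = ∃[ u ] ∃[ w ] (Temporal {v} {u} w × e ∈ walkEdges w)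

  _ᵉ⇝ᵛ_ : Edge → Vertex → Set
  e ᵉ⇝ᵛ v = ∃[ u ] ∃[ w ] (Temporal {u} {v} w × e ∈ walkEdges w)

  -- _⊆_ is the order-preserving sublist relation: e occurs before e′,
  -- not necessarily consecutively.
  _ᵉ⇝ᵉ_ : Edge → Edge → Set
  e ᵉ⇝ᵉ e′ = e ≡ e′ ⊎
    (∃[ u ] ∃[ v ] ∃[ w ] (Temporal {u} {v} w × (e ∷ e′ ∷ []) ⊆ walkEdges w))

  TemporallyConnected : Set
  TemporallyConnected = ∀ u v → u ᵛ⇝ᵛ v

  incidentEdges : Vertex → List Edge
  incidentEdges v = filter (incident? v) (allFin ∣E∣)

  -- The edge witnessing non-isolation only seeds the search; by label-proper
  -- the result does not depend on it.
  e⁻ e⁺ : (v : Vertex) → NonIsolated v → Edge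
  e⁻ v (e , _) = argmin label e (incidentEdges v)
  e⁺ v (e , _) = argmax label e (incidentEdges v)

  e⁻-incident : ∀ v (n : NonIsolated v) → Incident v (e⁻ v n)
  e⁻-incident v (_ , i) = argmin-all label i (all-filter (incident? v) (allFin ∣E∣))

  e⁺-incident : ∀ v (n : NonIsolated v) → Incident v (e⁺ v n)
  e⁺-incident v (_ , i) = argmax-all label i (all-filter (incident? v) (allFin ∣E∣))

  e⁻-smallest : ∀ v (n : NonIsolated v) {e} → Incident v e → label (e⁻ v n) ≤ label e
  e⁻-smallest v (d , _) {e} i =
    All.lookup (f[argmin]≤f[xs] d (incidentEdges v)) (∈-filter⁺ (incident? v) (∈-allFin e) i)

  e⁺-largest : ∀ v (n : NonIsolated v) {e} → Incident v e → label e ≤ label (e⁺ v n)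
  e⁺-largest v (d , _) {e} i =
    All.lookup (f[xs]≤f[argmax] d (incidentEdges v)) (∈-filter⁺ (incident? v) (∈-allFin e) i)

{-# OPTIONS --safe #-}

-- A temporal walk that crosses e splits there into a part with labels below
-- label e and a part with labels above it.  Given two walks crossing e, the
-- first part of one and the second part of the other can be joined: through e
-- if both cross it in the same direction, and by skipping e otherwise.  A walk
-- from v whose first edge is not e⁻ v can be preceded by e⁻ v, and dually at
-- its end.
module Submission where

open import Defs
open import Data.Nat using (_≤_; _<_; _<?_; s≤s)
open import Data.Nat.Properties
  using (<-trans; <-irrefl; <-asym; <⇒≤; ≤-trans; ≤-refl; ≤-<-trans; ≤∧≢⇒<; <⇒≱)
open import Data.Fin using (Fin; zero; suc; _≟_)
open import Data.List using (List; []; _∷_; _++_)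
open import Data.List.Membership.Propositional using (_∈_)
open import Data.List.Membership.Propositional.Properties using (∈-++⁺ˡ; ∈-++⁺ʳ)
open import Data.List.Relation.Binary.Sublist.Propositional using (_⊆_; _∷ʳ_; _∷_; from∈; lookup)
open import Data.List.Relation.Unary.All as All using ([]; _∷_)
open import Data.List.Relation.Unary.AllPairs using (AllPairs; []; _∷_)
import Data.List.Relation.Unary.AllPairs.Properties as AllPairs
open import Data.List.Relation.Unary.Any using (here; there)
open import Data.List.Relation.Unary.Linked.Properties using (Linked⇒AllPairs; AllPairs⇒Linked)
open import Data.Product using (∃-syntax; _×_; _,_; proj₁)
open import Data.Sum using (_⊎_; inj₁; inj₂; swap; map₁)
open import Relation.Nullary using (¬_; yes; no; contradiction)
open import Relation.Binary.PropositionalEquality using (_≡_; _≢_; refl; sym; subst; cong)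

another : ∀ {n} → 2 ≤ n → (i : Fin n) → ∃[ j ] i ≢ j
another (s≤s (s≤s _)) zero    = suc zero , λ ()
another (s≤s (s≤s _)) (suc _) = zero , λ ()

module Reachability (G : HappyTemporalGraph) where
  open HappyTemporalGraph G

  -- Label order along a walk.

  Increasing : List Edge → Set
  Increasing = AllPairs (λ e e′ → label e < label e′)

  private variable
    u v x y : Vertex
    e e′    : Edge
    es      : List Edge

  -- Transitivity of `<` compares each edge with every later one, so a bound on any later edge
  -- becomes a mere `All.lookup`.
  temporal⇒increasing : (w : Walk u v) → Temporal w → Increasing (walkEdges w)
  temporal⇒increasing _ = Linked⇒AllPairs <-trans

  increasing⇒temporal : (w : Walk u v) → Increasing (walkEdges w) → Temporal w
  increasing⇒temporal _ = AllPairs⇒Linked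

  pair⇒< : Increasing es → (e ∷ e′ ∷ []) ⊆ es → label e < label e′
  pair⇒< (_   ∷ inc) (_ ∷ʳ p)   = pair⇒< inc p
  pair⇒< (e<s ∷ _)   (refl ∷ p) = All.lookup e<s (lookup p (here refl))

  -- If `e′` stood first, its label would be the smaller one. Since label order thus fixes list
  -- order, walks built later need only record membership. Both memberships may point to the same
  -- position, hence the equality case.
  ordered-pair : Increasing es → e ∈ es → e′ ∈ es → label e ≤ label e′ →
                 e ≡ e′ ⊎ (e ∷ e′ ∷ []) ⊆ es
  ordered-pair _           (here refl) (here refl) _  = inj₁ refl
  ordered-pair _           (here refl) (there q)   _  = inj₂ (refl ∷ from∈ q)
  ordered-pair (e<s ∷ _)   (there p)   (here refl) le = contradiction le (<⇒≱ (All.lookup e<s p))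
  ordered-pair (_   ∷ inc) (there p)   (there q)   le with ordered-pair inc p q le
  ... | inj₁ eq  = inj₁ eq
  ... | inj₂ sub = inj₂ (_ ∷ʳ sub)

  ordered⇒⇝ : (w : Walk u v) → Increasing (walkEdges w) →
              e ∈ walkEdges w → e′ ∈ walkEdges w → label e ≤ label e′ → e ᵉ⇝ᵉ e′
  ordered⇒⇝ w inc p q le with ordered-pair inc p q le
  ... | inj₁ eq  = inj₁ eq
  ... | inj₂ sub = inj₂ (_ , _ , w , increasing⇒temporal w inc , sub)

  ⇝⇒≤ : e ᵉ⇝ᵉ e′ → label e ≤ label e′
  ⇝⇒≤ (inj₁ refl)                   = ≤-refl
  ⇝⇒≤ (inj₂ (_ , _ , w , tw , sub)) = <⇒≤ (pair⇒< (temporal⇒increasing w tw) sub)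

  ⇝∧≢⇒< : e ᵉ⇝ᵉ e′ → e ≢ e′ → label e < label e′
  ⇝∧≢⇒< (inj₁ eq)                     e≢e′ = contradiction eq e≢e′
  ⇝∧≢⇒< (inj₂ (_ , _ , w , tw , sub)) _    = pair⇒< (temporal⇒increasing w tw) sub

  -- Concatenation of walks.

  infixr 5 _++ʷ_

  _++ʷ_ : ∀ {u v x} → Walk u v → Walk v x → Walk u x
  []            ++ʷ w′ = w′
  (e ∷⟨ j ⟩ w) ++ʷ w′ = e ∷⟨ j ⟩ (w ++ʷ w′)

  walkEdges-++ : (w : Walk u v) (w′ : Walk v x) → walkEdges (w ++ʷ w′) ≡ walkEdges w ++ walkEdges w′
  walkEdges-++ []            w′ = refl
  walkEdges-++ (e ∷⟨ _ ⟩ w) w′ = cong (e ∷_) (walkEdges-++ w w′)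

  infix 4 _∈ʷ_

  _∈ʷ_ : Edge → Walk u v → Set
  e ∈ʷ w = e ∈ walkEdges w

  _⊑_ : ∀ {u v x y} → Walk u v → Walk x y → Set
  w ⊑ w′ = ∀ {f} → f ∈ʷ w → f ∈ʷ w′

  ++ʷ-⊑ˡ : (w : Walk u v) (w′ : Walk v x) → w ⊑ (w ++ʷ w′)
  ++ʷ-⊑ˡ w w′ p = subst (_ ∈_) (sym (walkEdges-++ w w′)) (∈-++⁺ˡ p)

  ++ʷ-⊑ʳ : (w : Walk u v) (w′ : Walk v x) → w′ ⊑ (w ++ʷ w′)
  ++ʷ-⊑ʳ w w′ p = subst (_ ∈_) (sym (walkEdges-++ w w′)) (∈-++⁺ʳ (walkEdges w) p)

  ++ʷ-increasing : (w : Walk u v) (w′ : Walk v x) →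
    Increasing (walkEdges w) → Increasing (walkEdges w′) →
    (∀ {f g} → f ∈ʷ w → g ∈ʷ w′ → label f < label g) → Increasing (walkEdges (w ++ʷ w′))
  ++ʷ-increasing w w′ inc inc′ f<g = subst Increasing (sym (walkEdges-++ w w′))
    (AllPairs.++⁺ inc inc′ (All.tabulate λ p → All.tabulate λ q → f<g p q))

  -- Splitting a walk at an edge, and rerouting.

  record Crossing (e : Edge) {u v} (w : Walk u v) : Set where
    field
      {near far}        : Vertex
      joins             : Joins e near far
      before            : Walk u near
      after             : Walk far v
      before-increasing : Increasing (walkEdges before)
      after-increasing  : Increasing (walkEdges after)
      before<e          : ∀ {f} → f ∈ʷ before → label f < label e
      e<after           : ∀ {f} → f ∈ʷ after → label e < label f
      before-⊑          : before ⊑ w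
      locate            : ∀ {f} → f ∈ʷ w → f ∈ʷ before ⊎ f ≡ e ⊎ f ∈ʷ after

    -- Of the three places offered by `locate`, `e` itself and the `after` part carry labels at
    -- least that of `e`, so the label alone decides the side.
    <⇒∈before : ∀ {f} → f ∈ʷ w → label f < label e → f ∈ʷ before
    <⇒∈before p f<e with locate p
    ... | inj₁ q           = q
    ... | inj₂ (inj₁ refl) = contradiction f<e (<-irrefl refl)
    ... | inj₂ (inj₂ q)    = contradiction f<e (<-asym (e<after q))

    >⇒∈after : ∀ {f} → f ∈ʷ w → label e < label f → f ∈ʷ after
    >⇒∈after p e<f with locate p
    ... | inj₁ q           = contradiction e<f (<-asym (before<e q))
    ... | inj₂ (inj₁ refl) = contradiction e<f (<-irrefl refl)
    ... | inj₂ (inj₂ q)    = q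

  crossing : (w : Walk u v) → Increasing (walkEdges w) → e ∈ʷ w → Crossing e w
  crossing (e ∷⟨ j ⟩ w) (e<w ∷ inc) (here refl) = record
    { joins             = j
    ; before            = []
    ; after             = w
    ; before-increasing = []
    ; after-increasing  = inc
    ; before<e          = λ ()
    ; e<after           = All.lookup e<w
    ; before-⊑          = λ ()
    ; locate            = λ { (here eq) → inj₂ (inj₁ eq) ; (there p) → inj₂ (inj₂ p) }
    }
  crossing (d ∷⟨ j ⟩ w) (d<w ∷ inc) (there p) = record
    { joins             = joins
    ; before            = d ∷⟨ j ⟩ before
    ; after             = after
    -- `before-⊑` puts the recursive `before` inside the tail `w`, whose labels all exceed that of
    -- `d`.
    ; before-increasing = All.tabulate (λ q → All.lookup d<w (before-⊑ q)) ∷ before-increasing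
    ; after-increasing  = after-increasing
    ; before<e          = λ { (here refl) → All.lookup d<w p ; (there q) → before<e q }
    ; e<after           = e<after
    ; before-⊑          = λ { (here eq) → here eq ; (there q) → there (before-⊑ q) }
    ; locate            = λ { (here eq) → inj₁ (here eq) ; (there q) → map₁ there (locate q) }
    }
    where open Crossing (crossing w inc p)

  -- The last alternative is traversal in opposite directions. Of its two equations only `u ≡ y` is
  -- kept: the first walk reaches `e` at the vertex where the second leaves it, which is what
  -- skipping `e` requires.
  joins-unique : ∀ {u v x y} → Joins e u v → Joins e x y → (u ≡ x × v ≡ y) ⊎ u ≡ y
  joins-unique (inj₁ (refl , refl)) (inj₁ (refl , refl)) = inj₁ (refl , refl)
  joins-unique (inj₁ (refl , refl)) (inj₂ (refl , refl)) = inj₂ refl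
  joins-unique (inj₂ (refl , refl)) (inj₁ (refl , refl)) = inj₂ refl
  joins-unique (inj₂ (refl , refl)) (inj₂ (refl , refl)) = inj₁ (refl , refl)

  -- Even if the join uses e, its occurrence is not recorded: when the two
  -- walks cross e in opposite directions, e is skipped.
  reroute : {w : Walk u v} {w′ : Walk x y} (c : Crossing e w) (c′ : Crossing e w′) →
    ∃[ w″ ] Increasing (walkEdges {u} {y} w″) × Crossing.before c ⊑ w″ × Crossing.after c′ ⊑ w″
  reroute {e = e} c c′ with joins-unique (Crossing.joins c) (Crossing.joins c′)
  ... | inj₁ (refl , refl) =
      b ++ʷ ea
    , ++ʷ-increasing b ea (before-increasing c) (All.tabulate (e<after c′) ∷ after-increasing c′)
        (λ { p (here refl) → before<e c p ; p (there q) → <-trans (before<e c p) (e<after c′ q) })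
    , ++ʷ-⊑ˡ b ea
    , λ q → ++ʷ-⊑ʳ b ea (there q)
    where
    open Crossing
    b  = before c
    ea = e ∷⟨ joins c ⟩ after c′
  ... | inj₂ refl =
      b ++ʷ a
    , ++ʷ-increasing b a (before-increasing c) (after-increasing c′)
        (λ p q → <-trans (before<e c p) (e<after c′ q))
    , ++ʷ-⊑ˡ b a
    , ++ʷ-⊑ʳ b a
    where
    open Crossing
    b = before c
    a = after c′

  -- On the first walk `e₁` has a label strictly below that of `e₂`, and on the second `e₃` has one
  -- strictly above, so both survive the rerouting even if `e₂` is skipped. Their labels then give
  -- their order on the new walk.
  ᵉ⇝ᵉ-trans : ∀ {e₁ e₂ e₃} → e₁ ᵉ⇝ᵉ e₂ → e₂ ᵉ⇝ᵉ e₃ → e₁ ᵉ⇝ᵉ e₃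
  ᵉ⇝ᵉ-trans (inj₁ refl) r₂          = r₂
  ᵉ⇝ᵉ-trans r₁@(inj₂ _) (inj₁ refl) = r₁
  ᵉ⇝ᵉ-trans r₁@(inj₂ (_ , _ , w , tw , sub)) r₂@(inj₂ (_ , _ , w′ , tw′ , sub′)) =
    let inc  = temporal⇒increasing w tw
        inc′ = temporal⇒increasing w′ tw′
        c    = crossing w inc (lookup sub (there (here refl)))
        c′   = crossing w′ inc′ (lookup sub′ (here refl))
        (w″ , inc″ , b⊑ , a⊑) = reroute c c′
    in ordered⇒⇝ w″ inc″
         (b⊑ (Crossing.<⇒∈before c (lookup sub (here refl)) (pair⇒< inc sub)))
         (a⊑ (Crossing.>⇒∈after c′ (lookup sub′ (there (here refl))) (pair⇒< inc′ sub′)))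
         (≤-trans (⇝⇒≤ r₁) (⇝⇒≤ r₂))

  ᵛ⇝ᵉ-trans : v ᵛ⇝ᵉ e → e ᵉ⇝ᵉ e′ → v ᵛ⇝ᵉ e′
  ᵛ⇝ᵉ-trans r (inj₁ refl) = r
  ᵛ⇝ᵉ-trans (_ , w , tw , p) (inj₂ (_ , _ , w′ , tw′ , sub)) =
    let inc′ = temporal⇒increasing w′ tw′
        c′   = crossing w′ inc′ (lookup sub (here refl))
        (w″ , inc″ , _ , a⊑) = reroute (crossing w (temporal⇒increasing w tw) p) c′
    in _ , w″ , increasing⇒temporal w″ inc″ ,
       a⊑ (Crossing.>⇒∈after c′ (lookup sub (there (here refl))) (pair⇒< inc′ sub))

  -- Only the endpoints of the rerouted walk matter, so skipping `e` is harmless, even if the walk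
  -- becomes empty.
  ᵛ⇝ᵛ-via-edge : u ᵛ⇝ᵉ e → e ᵉ⇝ᵛ v → u ᵛ⇝ᵛ v
  ᵛ⇝ᵛ-via-edge (_ , w , tw , p) (_ , w′ , tw′ , p′) =
    let (w″ , inc″ , _) = reroute (crossing w (temporal⇒increasing w tw) p)
                                  (crossing w′ (temporal⇒increasing w′ tw′) p′)
    in w″ , increasing⇒temporal w″ inc″

  -- Extremal edges at the ends of a walk.

  joins-sym : Joins e u v → Joins e v u
  joins-sym = swap

  joins⇒incidentˡ : Joins e u v → Incident u e
  joins⇒incidentˡ (inj₁ (p , _)) = inj₁ p
  joins⇒incidentˡ (inj₂ (_ , q)) = inj₂ q

  incident⇒joins : Incident v e → ∃[ x ] Joins e v x
  incident⇒joins (inj₁ p) = _ , inj₁ (p , refl)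
  incident⇒joins (inj₂ p) = _ , inj₂ (refl , p)

  -- Distinct edges at a common vertex are adjacent, so properness makes the weak extremality of
  -- `e⁻` and `e⁺` strict, as an extended walk needs.
  proper-< : Incident v e → Incident v e′ → e ≢ e′ → label e ≤ label e′ → label e < label e′
  proper-< i i′ e≢e′ e≤e′ = ≤∧≢⇒< e≤e′ (label-proper (e≢e′ , _ , i , i′))

  -- Labels increase, so the maximum sits on the edge that enters `v`. The premise `e ∈ʷ w` excludes
  -- the empty walk.
  last-edge : (w : Walk u v) → Increasing (walkEdges w) → e ∈ʷ w →
    ∃[ d ] d ∈ʷ w × Incident v d × (∀ {f} → f ∈ʷ w → label f ≤ label d)
  last-edge (d ∷⟨ j ⟩ []) _ _ =
    d , here refl , joins⇒incidentˡ (joins-sym j) , λ { (here refl) → ≤-refl }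
  last-edge (d ∷⟨ j ⟩ w@(_ ∷⟨ _ ⟩ _)) (d<w ∷ inc) _ with last-edge w inc (here refl)
  ... | l , l∈w , i , ≤l =
    l , there l∈w , i , λ { (here refl) → <⇒≤ (All.lookup d<w l∈w) ; (there q) → ≤l q }

  walk≤e⁺ : (n : NonIsolated v) (w : Walk u v) → Increasing (walkEdges w) →
            e ∈ʷ w → label e ≤ label (e⁺ v n)
  walk≤e⁺ n w inc p with last-edge w inc p
  ... | _ , _ , i , ≤d = ≤-trans (≤d p) (e⁺-largest _ n i)

  -- A prepended `e⁻` is crossed towards `u`, which moves the start to its other end; hence the
  -- existential `x`.
  starting-with-e⁻ : (n : NonIsolated u) (w : Walk u v) → Increasing (walkEdges w) →
    ∃[ x ] ∃[ w′ ] Increasing (walkEdges {x} {v} w′) × e⁻ u n ∈ʷ w′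
  starting-with-e⁻ {u} n [] _ =
    let (_ , j) = incident⇒joins (e⁻-incident u n)
    in _ , (e⁻ u n ∷⟨ joins-sym j ⟩ []) , [] ∷ [] , here refl
  starting-with-e⁻ {u} n w@(d ∷⟨ j ⟩ w₀) inc@(d<w₀ ∷ _) with e⁻ u n ≟ d
  ... | yes eq = _ , w , inc , here eq
  ... | no  ne =
    let i       = e⁻-incident u n
        i′      = joins⇒incidentˡ j
        (_ , k) = incident⇒joins i
        m<d     = proper-< i i′ ne (e⁻-smallest u n i′)
    in _ , (e⁻ u n ∷⟨ joins-sym k ⟩ w)
         , (m<d ∷ All.map (<-trans m<d) d<w₀) ∷ inc
         , here refl

  -- `w ⊑ w′` is carried along so that an `e⁻` placed at the start is still present after the
  -- extension at the end.
  ending-with-e⁺ : (n : NonIsolated v) (w : Walk u v) → Increasing (walkEdges w) →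
    ∃[ y ] ∃[ w′ ] Increasing (walkEdges {u} {y} w′) × w ⊑ w′ × e⁺ v n ∈ʷ w′
  ending-with-e⁺ {v} n [] _ =
    let (_ , j) = incident⇒joins (e⁺-incident v n)
    in _ , (e⁺ v n ∷⟨ j ⟩ []) , [] ∷ [] , (λ ()) , here refl
  ending-with-e⁺ {v} n w@(_ ∷⟨ _ ⟩ _) inc with last-edge w inc (here refl)
  ... | d , d∈w , i , ≤d with d ≟ e⁺ v n
  ... | yes refl = _ , w , inc , (λ p → p) , d∈w
  ... | no  ne   =
    let i′      = e⁺-incident v n
        (_ , j) = incident⇒joins i′
        l       = e⁺ v n ∷⟨ j ⟩ []
    in _ , w ++ʷ l
         , ++ʷ-increasing w l inc ([] ∷ [])
             (λ { p (here refl) → ≤-<-trans (≤d p) (proper-< i i′ ne (e⁺-largest v n i)) })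
         , ++ʷ-⊑ˡ w l
         , ++ʷ-⊑ʳ w l (here refl)

  ᵛ⇝ᵛ⇒extremal : (nv : NonIsolated v) (nu : NonIsolated u) → v ᵛ⇝ᵛ u →
    (e⁻ v nv ᵉ⇝ᵛ u) × (v ᵛ⇝ᵉ e⁺ u nu) × (e⁻ v nv ᵉ⇝ᵉ e⁺ u nu)
  ᵛ⇝ᵛ⇒extremal nv nu (w , tw) =
    let inc                             = temporal⇒increasing w tw
        (_ , w₁ , inc₁ , e⁻∈w₁)         = starting-with-e⁻ nv w inc
        (_ , w₂ , inc₂ , _     , e⁺∈w₂) = ending-with-e⁺ nu w inc
        -- Extending `w₁` rather than `w` puts both extremal edges on one walk.
        (_ , w₃ , inc₃ , w₁⊑w₃ , e⁺∈w₃) = ending-with-e⁺ nu w₁ inc₁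
    in (_ , w₁ , increasing⇒temporal w₁ inc₁ , e⁻∈w₁)
     , (_ , w₂ , increasing⇒temporal w₂ inc₂ , e⁺∈w₂)
     -- `w₁` ends at `u`, so the label of `e⁺` bounds all labels on it, that of `e⁻` included. If
     -- the two edges coincide, `ordered⇒⇝` returns the equality.
     , ordered⇒⇝ w₃ inc₃ (w₁⊑w₃ e⁻∈w₁) e⁺∈w₃ (walk≤e⁺ nu w₁ inc₁ e⁻∈w₁)

  walk⇒nonIsolated : u ≢ v → Walk u v → NonIsolated u
  walk⇒nonIsolated u≢v []           = contradiction refl u≢v
  walk⇒nonIsolated _   (e ∷⟨ j ⟩ _) = e , joins⇒incidentˡ j

  -- A walk from `v` to some other vertex has a first edge, and that edge is incident to `v`.
  connected⇒nonIsolated : TemporallyConnected → 2 ≤ ∣V∣ → ∀ v → NonIsolated v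
  connected⇒nonIsolated conn 2≤∣V∣ v =
    let (u , v≢u) = another 2≤∣V∣ v
    in walk⇒nonIsolated v≢u (proj₁ (conn v u))

  -- Reachability between distinct edges raises the label strictly. With equal labels both
  -- directions fail, and the first alternative is chosen.
  ᵉ⇝ᵉ-one-way : ∀ e₁ e₂ → e₁ ≢ e₂ → ¬ (e₁ ᵉ⇝ᵉ e₂) ⊎ ¬ (e₂ ᵉ⇝ᵉ e₁)
  ᵉ⇝ᵉ-one-way e₁ e₂ e₁≢e₂ with label e₁ <? label e₂
  ... | yes e₁<e₂ = inj₂ λ r → <⇒≱ e₁<e₂ (⇝⇒≤ r)
  ... | no  e₁≮e₂ = inj₁ λ r → e₁≮e₂ (⇝∧≢⇒< r e₁≢e₂)

lemma3p1 : (G : HappyTemporalGraph) → let open HappyTemporalGraph G in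
    Compressed →
    (∀ e₁ e₂ e₃ → e₁ ᵉ⇝ᵉ e₂ → e₂ ᵉ⇝ᵉ e₃ → e₁ ᵉ⇝ᵉ e₃)
    × (∀ v e₁ e₂ → v ᵛ⇝ᵉ e₁ → e₁ ᵉ⇝ᵉ e₂ → v ᵛ⇝ᵉ e₂)
    × (∀ v v′ e → v ᵛ⇝ᵉ e → e ᵉ⇝ᵛ v′ → v ᵛ⇝ᵛ v′)
    × (∀ u v (nu : NonIsolated u) (nv : NonIsolated v) → v ᵛ⇝ᵛ u →
    (e⁻ v nv ᵉ⇝ᵛ u) × (v ᵛ⇝ᵉ e⁺ u nu) × (e⁻ v nv ᵉ⇝ᵉ e⁺ u nu))
    × (TemporallyConnected → 2 ≤ ∣V∣ →
    (∀ v → NonIsolated v)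
    × (∀ u v (nu : NonIsolated u) (nv : NonIsolated v) →
    (e⁻ u nu ᵉ⇝ᵛ v) × (u ᵛ⇝ᵉ e⁺ v nv) × (e⁻ u nu ᵉ⇝ᵉ e⁺ v nv)))
    × (∀ e₁ e₂ → e₁ ≢ e₂ → ¬ (e₁ ᵉ⇝ᵉ e₂) ⊎ ¬ (e₂ ᵉ⇝ᵉ e₁))
lemma3p1 G _ =
    (λ _ _ _ → ᵉ⇝ᵉ-trans)
  , (λ _ _ _ → ᵛ⇝ᵉ-trans)
  , (λ _ _ _ → ᵛ⇝ᵛ-via-edge)
  , (λ _ _ nu nv → ᵛ⇝ᵛ⇒extremal nv nu)
  , (λ conn 2≤∣V∣ → connected⇒nonIsolated conn 2≤∣V∣
                  , λ u v nu nv → ᵛ⇝ᵛ⇒extremal nu nv (conn u v))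
  , ᵉ⇝ᵉ-one-way
  where open Reachability G
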